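{- Let $B$ be a type. For all $x,y:B^\nu$ and $b:B$, if $\mathsf{fstconv}\,x\,y\downarrow b$ then $x\downarrow b$ or $y\downarrow b$.
   Context: Work in an intensional constructive dependent type theory with inductive and coinductive types. For a type $B$, $B^\nu$ is the coinductive type with constructors $\mathsf{return}:B\to B^\nu$ and $\mathsf{step}:B^\nu\to B^\nu$. Convergence $x\downarrow b$ is inductive: $\mathsf{return}\,b\downarrow b$; $x\downarrow b\Rightarrow\mathsf{step}\,x\downarrow b$. The function $\mathsf{fstconv}:B^\nu\to B^\nu\to B^\nu$ is defined corecursively by $\mathsf{fstconv}\,(\mathsf{return}\,b)\,y=\mathsf{return}\,b$; $\mathsf{fstconv}\,(\mathsf{step}\,x)\,(\mathsf{return}\,b)=\mathsf{return}\,b$; $\mathsf{fstconv}\,(\mathsf{step}\,x)\,(\mathsf{step}\,y)=\mathsf{step}(\mathsf{fstconv}\,x\,y)$. -}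

module Defs where

open import Data.Nat using (ℕ; zero; suc)
open import Data.Maybe using (Maybe; just; nothing)
open import Relation.Binary.PropositionalEquality using (_≡_)

-- B^ν : the coinductive type with constructors
--   return : B → B^ν   and   step : B^ν → B^ν.
-- Coinductive types (--guardedness / --sized-types / musical ∞) are not
-- available in this checking setup, so B^ν is encoded as the final
-- coalgebra of X ↦ B + X by its observation sequence:
--   x n ≡ just b   : "after n steps, x is return b",
--   x n ≡ nothing  : "after n steps, x is a step".
-- Only the first 'just' is observable: every definition below ignores
-- the entries after it.
Delay : ∀ {a} → Set a → Set a
Delay B = ℕ → Maybe B

tail : ∀ {a} {B : Set a} → Delay B → Delay B
tail x n = x (suc n)

return : ∀ {a} {B : Set a} → B → Delay B
return b _ = just b

step : ∀ {a} {B : Set a} → Delay B → Delay B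
step x zero    = nothing
step x (suc n) = x n

-- Convergence x ↓ b (inductive):
--   return b ↓ b ;  x ↓ b ⇒ step x ↓ b
-- phrased on the one-layer unfolding of x.
data _↓_ {a} {B : Set a} : Delay B → B → Set a where
  ret↓  : ∀ {x b} → x 0 ≡ just b → x ↓ b
  step↓ : ∀ {x b} → x 0 ≡ nothing → tail x ↓ b → x ↓ b

-- fstconv, defined by the corecursive equations
--   fstconv (return b) y          = return b
--   fstconv (step x) (return b)   = return b
--   fstconv (step x) (step y)     = step (fstconv x y)
-- read off at each observation depth n.
fstconv : ∀ {a} {B : Set a} → Delay B → Delay B → Delay B
fstconv x y n with x 0 | y 0
... | just b  | _       = just b
... | nothing | just b  = just b
... | nothing | nothing with n
...   | zero  = nothing
...   | suc m = fstconv (tail x) (tail y) m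

{-# OPTIONS --safe #-}
module Submission where

open import Defs
open import Data.Nat using (suc)
open import Data.Maybe using (just; nothing)
open import Data.Product using (_×_; _,_)
open import Data.Sum using (_⊎_; inj₁; inj₂)
import Data.Sum as Sum
open import Relation.Binary.PropositionalEquality using (_≡_; refl; sym; trans; _≗_)

module _ {a} {B : Set a} where

  fstconv-now : ∀ (x y : Delay B) {b} → fstconv x y 0 ≡ just b → x 0 ≡ just b ⊎ y 0 ≡ just b
  fstconv-now x y fxy₀ with x 0 | y 0
  ... | just _  | _       = inj₁ fxy₀
  ... | nothing | just _  = inj₂ fxy₀
  fstconv-now x y () | nothing | nothing

  fstconv-later : ∀ (x y : Delay B) → fstconv x y 0 ≡ nothing → x 0 ≡ nothing × y 0 ≡ nothing
  fstconv-later x y fxy₀ with x 0 | y 0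
  ... | nothing | nothing = refl , refl
  fstconv-later x y () | just _  | _
  fstconv-later x y () | nothing | just _

  fstconv-tail : ∀ (x y : Delay B) → x 0 ≡ nothing → y 0 ≡ nothing →
                 tail (fstconv x y) ≗ fstconv (tail x) (tail y)
  fstconv-tail x y x₀ y₀ n with x 0 | y 0
  fstconv-tail x y refl refl n | nothing | nothing = refl

  -- Generalised from z ≡ fstconv x y because the tail of fstconv x y is only
  -- pointwise equal to fstconv (tail x) (tail y).
  fstconv-↓⁻¹ : ∀ (x y : Delay B) {z b} → z ≗ fstconv x y → z ↓ b → x ↓ b ⊎ y ↓ b
  fstconv-↓⁻¹ x y z≗ (ret↓ z₀) = Sum.map ret↓ ret↓ (fstconv-now x y (trans (sym (z≗ 0)) z₀))
  fstconv-↓⁻¹ x y z≗ (step↓ z₀ tail-z↓) with fstconv-later x y (trans (sym (z≗ 0)) z₀)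
  ... | x₀ , y₀ = Sum.map (step↓ x₀) (step↓ y₀)
    (fstconv-↓⁻¹ (tail x) (tail y) (λ n → trans (z≗ (suc n)) (fstconv-tail x y x₀ y₀ n)) tail-z↓)

lemma6p10 : ∀ {a} {B : Set a} (x y : Delay B) (b : B) → fstconv x y ↓ b → x ↓ b ⊎ y ↓ b
lemma6p10 x y b = fstconv-↓⁻¹ x y (λ _ → refl)
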